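{- The class of cyclic proofs of $\mathsf{TC}_G$ does not enjoy cut-admissibility: there is a sequent that has a cyclic proof in $\mathsf{TC}_G$ extended by the cut rule but has no cyclic proof in (cut-free) $\mathsf{TC}_G$.
   Context: **Language.** Fix countable sets of unary predicate symbols $p,q,\dots$, of binary relation symbols $a,b,\dots$, and of function symbols, each with an arity $n\ge 0$ (nullary ones are constant symbols $c,d,\dots$). Terms $s,t,\dots$ are built from variables and function symbols. TCL formulas: $A,B ::= p(t)\mid\bar p(t)\mid a(s,t)\mid\bar a(s,t)\mid A\wedge B\mid A\vee B\mid\forall xA\mid\exists xA\mid TC(\lambda x,y.A)(s,t)\mid\overline{TC}(\lambda x,y.A)(s,t)$. We write $TC(A)(s,t)$, $\overline{TC}(A)(s,t)$ when $x,y$ are clear, and $A(s,t)$ for $A[s/x,t/y]$. The complement $\bar A$ is given by De Morgan duality: $p(t)/\bar p(t)$, $a(s,t)/\bar a(s,t)$, $\wedge/\vee$, $\forall/\exists$ are swapped, $\overline{TC(A)(s,t)}:=\overline{TC}(\bar A)(s,t)$ and $\overline{\overline{TC}(A)(s,t)}:=TC(\bar A)(s,t)$. **System $\mathsf{TC}_G$** (no cut). Sequents $\Gamma,\Delta$ are sets of formulas (formulas of the form $s=t$, $s\neq t$, complementary to each other, are also allowed in this system). Rules (premisses $\Rightarrow$ conclusion): - $\mathsf{id}$: axiom $\Gamma,p(t),\bar p(t)$. - $\vee_i$ ($i\in\{0,1\}$): $\Gamma,A_i\Rightarrow\Gamma,A_0\vee A_1$. - $\wedge$: $\Gamma,A$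 and $\Gamma,B$ $\Rightarrow\Gamma,A\wedge B$. - $\exists$: $\Gamma,A(t)\Rightarrow\Gamma,\exists xA(x)$. - $\forall$: $\Gamma,A[c/x]\Rightarrow\Gamma,\forall xA$, $c$ a fresh constant. - $\mathsf{wk}$: $\Gamma\Rightarrow\Gamma,\Gamma'$. - $=$: axiom $\Gamma,t=t$. - $\neq$: $\Gamma,A(t)\Rightarrow\Gamma,s\neq t,A(s)$, and $\Gamma,A(s)\Rightarrow\Gamma,s\neq t,A(t)$. - substitution $\sigma$: $\Gamma\Rightarrow\sigma(\Gamma)$, where $\sigma$ maps constants to terms and other function symbols to function symbols of the same arity. - $TC_0$: $\Gamma,A(s,t)\Rightarrow\Gamma,TC(A)(s,t)$. - $TC_1$: $\Gamma,A(s,r)$ and $\Gamma,TC(A)(r,t)$ $\Rightarrow\Gamma,TC(A)(s,t)$. - $\overline{TC}$: $\Gamma,A(s,t)$ and $\Gamma,A(s,c),\overline{TC}(A)(c,t)$ $\Rightarrow\Gamma,\overline{TC}(A)(s,t)$, $c$ a fresh constant (the eigenvariable). The cut rule is: $\Gamma,A$ and $\Gamma,\bar A$ $\Rightarrow\Gamma$. A preproof is a possibly infinite tree of sequents generated by the rules; it is regular if it has only finitely many distinct sub-preproofs. Along an infinite branch with inference steps $(\mathsf r_i)_{i\in\omega}$ a trace is a sequence of formulas $(\overline{TC}(A)(s_i,t_i))_{i\ge k}$ (the $i$-th occurring in the conclusion of $\mathsf r_i$) such that for all $i\ge k$ either: (1) $\mathsf r_i$ is not a substitution step and $(s_{i+1},t_{i+1})=(s_i,t_i)$;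 or (2) $\mathsf r_i$ is a $\overline{TC}$ step with principal formula $\overline{TC}(A)(s_i,t_i)$ and $(s_{i+1},t_{i+1})=(c,t_i)$, with $c$ the eigenvariable of $\mathsf r_i$; or (3) $\mathsf r_i$ is a substitution step w.r.t. $\sigma$ and $(\sigma(s_{i+1}),\sigma(t_{i+1}))=(s_i,t_i)$. It is progressing if case (2) occurs infinitely often. A proof is a preproof each of whose infinite branches has a progressing trace; a cyclic proof is a regular proof. The same notions apply to the extension by cut. -}

module Defs where

open import Data.Empty using (⊥)
open import Data.Fin.Base using (Fin; zero; suc)
open import Data.List.Base using (List; []; _∷_; [_]; _++_; _∷ʳ_; map; head; drop)
open import Data.List.Membership.Propositional using (_∈_)
open import Data.List.Relation.Binary.BagAndSetEquality using (_∼[_]_; set)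
open import Data.List.Relation.Unary.All using (All)
open import Data.List.Relation.Unary.Any using (Any)
open import Data.Maybe using (Maybe; just; nothing; Is-just)
open import Data.Maybe.Relation.Binary.Pointwise using (Pointwise)
open import Data.Nat.Base using (ℕ; zero; suc; _≤_)
open import Data.Product.Base using (∃-syntax; Σ-syntax; _×_)
open import Data.Sum.Base using (_⊎_)
open import Data.Unit.Base using (⊤)
open import Data.Vec.Base using (Vec; []; _∷_)
open import Relation.Binary.PropositionalEquality.Core using (_≡_; _≢_)
open import Relation.Nullary.Negation.Core using (¬_)

infixr 6 _∧_
infixr 5 _∨_
infix  7 _≐_ _≭_

-- Unary predicate symbols, binary relation symbols, and the function symbols
-- of each arity are all indexed by ℕ; a function symbol is the pair of its
-- arity and its index, and constants are the function symbols of arity 0.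
--
-- Binding is locally nameless: Term n and Formula n have n bound variables in
-- scope (index 0 innermost) besides the named free variables, so formulas are
-- identified up to α-equivalence.  Those occurring in sequents have type
-- Formula 0.

data Term (n : ℕ) : Set where
  free  : ℕ → Term n
  bound : Fin n → Term n
  fun   : (arity f : ℕ) → Vec (Term n) arity → Term n

const : ∀ {n} → ℕ → Term n
const c = fun 0 c []

-- In TC A s t and coTC A s t, i.e. TC(λx,y.A)(s,t) and its dual, the bound
-- variable 0 of A is x and the bound variable 1 is y.
data Formula (n : ℕ) : Set where
  pred npred : ℕ → Term n → Formula n
  rel  nrel  : ℕ → Term n → Term n → Formula n
  _≐_  _≭_   : Term n → Term n → Formula n
  _∧_  _∨_   : Formula n → Formula n → Formula n
  all  ex    : Formula (suc n) → Formula n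
  TC   coTC  : Formula (suc (suc n)) → Term n → Term n → Formula n

complement : ∀ {n} → Formula n → Formula n
complement (pred p t)   = npred p t
complement (npred p t)  = pred p t
complement (rel a s t)  = nrel a s t
complement (nrel a s t) = rel a s t
complement (s ≐ t)      = s ≭ t
complement (s ≭ t)      = s ≐ t
complement (A ∧ B)      = complement A ∨ complement B
complement (A ∨ B)      = complement A ∧ complement B
complement (all A)      = ex (complement A)
complement (ex A)       = all (complement A)
complement (TC A s t)   = coTC (complement A) s t
complement (coTC A s t) = TC (complement A) s t

Inst : ℕ → ℕ → Set
Inst m n = Fin m → Term n

mutual
  instT : ∀ {m n} → Inst m n → Term m → Term n
  instT ρ (free x)     = free x
  instT ρ (bound i)    = ρ i
  instT ρ (fun k f ts) = fun k f (instTs ρ ts)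

  instTs : ∀ {m n k} → Inst m n → Vec (Term m) k → Vec (Term n) k
  instTs ρ []       = []
  instTs ρ (t ∷ ts) = instT ρ t ∷ instTs ρ ts

lift : ∀ {m n} → Inst m n → Inst (suc m) (suc n)
lift ρ zero    = bound zero
lift ρ (suc i) = instT (λ j → bound (suc j)) (ρ i)

inst : ∀ {m n} → Inst m n → Formula m → Formula n
inst ρ (pred p t)   = pred p (instT ρ t)
inst ρ (npred p t)  = npred p (instT ρ t)
inst ρ (rel a s t)  = rel a (instT ρ s) (instT ρ t)
inst ρ (nrel a s t) = nrel a (instT ρ s) (instT ρ t)
inst ρ (s ≐ t)      = instT ρ s ≐ instT ρ t
inst ρ (s ≭ t)      = instT ρ s ≭ instT ρ t
inst ρ (A ∧ B)      = inst ρ A ∧ inst ρ B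
inst ρ (A ∨ B)      = inst ρ A ∨ inst ρ B
inst ρ (all A)      = all (inst (lift ρ) A)
inst ρ (ex A)       = ex (inst (lift ρ) A)
inst ρ (TC A s t)   = TC (inst (lift (lift ρ)) A) (instT ρ s) (instT ρ t)
inst ρ (coTC A s t) = coTC (inst (lift (lift ρ)) A) (instT ρ s) (instT ρ t)

_⟨_⟩ : Formula 1 → Term 0 → Formula 0
A ⟨ t ⟩ = inst (λ { zero → t }) A

_⟨_,_⟩ : Formula 2 → Term 0 → Term 0 → Formula 0
A ⟨ s , t ⟩ = inst (λ { zero → s ; (suc zero) → t }) A

-- The substitutions of the substitution rule: constants go to terms, and
-- function symbols of arity suc k to function symbols of arity suc k.
record Subst : Set where
  field
    onConst : ℕ → Term 0
    onFun   : (k : ℕ) → ℕ → ℕ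
open Subst public

mutual
  substT : ∀ {n} → Subst → Term n → Term n
  substT σ (free x)           = free x
  substT σ (bound i)          = bound i
  substT σ (fun zero c _)     = instT (λ ()) (onConst σ c)
  substT σ (fun (suc k) f ts) = fun (suc k) (onFun σ k f) (substTs σ ts)

  substTs : ∀ {n k} → Subst → Vec (Term n) k → Vec (Term n) k
  substTs σ []       = []
  substTs σ (t ∷ ts) = substT σ t ∷ substTs σ ts

substF : ∀ {n} → Subst → Formula n → Formula n
substF σ (pred p t)   = pred p (substT σ t)
substF σ (npred p t)  = npred p (substT σ t)
substF σ (rel a s t)  = rel a (substT σ s) (substT σ t)
substF σ (nrel a s t) = nrel a (substT σ s) (substT σ t)
substF σ (s ≐ t)      = substT σ s ≐ substT σ t
substF σ (s ≭ t)      = substT σ s ≭ substT σ t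
substF σ (A ∧ B)      = substF σ A ∧ substF σ B
substF σ (A ∨ B)      = substF σ A ∨ substF σ B
substF σ (all A)      = all (substF σ A)
substF σ (ex A)       = ex (substF σ A)
substF σ (TC A s t)   = TC (substF σ A) (substT σ s) (substT σ t)
substF σ (coTC A s t) = coTC (substF σ A) (substT σ s) (substT σ t)

mutual
  FreshT : ∀ {n} → ℕ → Term n → Set
  FreshT c (free x)           = ⊤
  FreshT c (bound i)          = ⊤
  FreshT c (fun zero d _)     = d ≢ c
  FreshT c (fun (suc k) f ts) = FreshTs c ts

  FreshTs : ∀ {n k} → ℕ → Vec (Term n) k → Set
  FreshTs c []       = ⊤
  FreshTs c (t ∷ ts) = FreshT c t × FreshTs c ts

Fresh : ∀ {n} → ℕ → Formula n → Set
Fresh c (pred p t)   = FreshT c t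
Fresh c (npred p t)  = FreshT c t
Fresh c (rel a s t)  = FreshT c s × FreshT c t
Fresh c (nrel a s t) = FreshT c s × FreshT c t
Fresh c (s ≐ t)      = FreshT c s × FreshT c t
Fresh c (s ≭ t)      = FreshT c s × FreshT c t
Fresh c (A ∧ B)      = Fresh c A × Fresh c B
Fresh c (A ∨ B)      = Fresh c A × Fresh c B
Fresh c (all A)      = Fresh c A
Fresh c (ex A)       = Fresh c A
Fresh c (TC A s t)   = Fresh c A × FreshT c s × FreshT c t
Fresh c (coTC A s t) = Fresh c A × FreshT c s × FreshT c t

-- Finite sets of formulas are lists up to _∼[ set ]_, i.e. having the same
-- elements; order and multiplicity are immaterial everywhere below.
Sequent : Set
Sequent = List (Formula 0)

data System : Set where
  TCG TCG+cut : System

-- The name of an inference rule together with everything that determines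
-- its instance, apart from the side formulas.
data Rule : System → Set where
  id₁     : ∀ {S} (p : ℕ) (t : Term 0) → Rule S
  id₂     : ∀ {S} (a : ℕ) (s t : Term 0) → Rule S
  ∨₀ ∨₁   : ∀ {S} (A B : Formula 0) → Rule S
  ∧ᵣ      : ∀ {S} (A B : Formula 0) → Rule S
  ∃ᵣ      : ∀ {S} (A : Formula 1) (t : Term 0) → Rule S
  ∀ᵣ      : ∀ {S} (A : Formula 1) (c : ℕ) → Rule S
  wk      : ∀ {S} → Rule S
  =ᵣ      : ∀ {S} (t : Term 0) → Rule S
  ≠₀ ≠₁   : ∀ {S} (A : Formula 1) (s t : Term 0) → Rule S
  sub     : ∀ {S} (σ : Subst) → Rule S
  TC₀     : ∀ {S} (A : Formula 2) (s t : Term 0) → Rule S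
  TC₁     : ∀ {S} (A : Formula 2) (s r t : Term 0) → Rule S
  coTCᵣ   : ∀ {S} (A : Formula 2) (s t : Term 0) (c : ℕ) → Rule S
  cut     : (A : Formula 0) → Rule TCG+cut

-- Infers r Δs Γ: the premisses Δs yield the conclusion Γ by r.
data Infers : ∀ {S} → Rule S → List Sequent → Sequent → Set where
  id₁   : ∀ {S} {p t} Γ →
          Infers {S} (id₁ p t) [] (pred p t ∷ npred p t ∷ Γ)
  id₂   : ∀ {S} {a s t} Γ →
          Infers {S} (id₂ a s t) [] (rel a s t ∷ nrel a s t ∷ Γ)
  ∨₀    : ∀ {S} {A B} Γ →
          Infers {S} (∨₀ A B) [ A ∷ Γ ] ((A ∨ B) ∷ Γ)
  ∨₁    : ∀ {S} {A B} Γ →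
          Infers {S} (∨₁ A B) [ B ∷ Γ ] ((A ∨ B) ∷ Γ)
  ∧ᵣ    : ∀ {S} {A B} Γ →
          Infers {S} (∧ᵣ A B) ((A ∷ Γ) ∷ (B ∷ Γ) ∷ []) ((A ∧ B) ∷ Γ)
  ∃ᵣ    : ∀ {S} {A t} Γ →
          Infers {S} (∃ᵣ A t) [ A ⟨ t ⟩ ∷ Γ ] (ex A ∷ Γ)
  ∀ᵣ    : ∀ {S} {A c} Γ → All (Fresh c) (all A ∷ Γ) →
          Infers {S} (∀ᵣ A c) [ A ⟨ const c ⟩ ∷ Γ ] (all A ∷ Γ)
  wk    : ∀ {S} Γ Γ′ →
          Infers {S} wk [ Γ ] (Γ ++ Γ′)
  =ᵣ    : ∀ {S} {t} Γ →
          Infers {S} (=ᵣ t) [] ((t ≐ t) ∷ Γ)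
  ≠₀    : ∀ {S} {A s t} Γ →
          Infers {S} (≠₀ A s t) [ A ⟨ t ⟩ ∷ Γ ] ((s ≭ t) ∷ A ⟨ s ⟩ ∷ Γ)
  ≠₁    : ∀ {S} {A s t} Γ →
          Infers {S} (≠₁ A s t) [ A ⟨ s ⟩ ∷ Γ ] ((s ≭ t) ∷ A ⟨ t ⟩ ∷ Γ)
  sub   : ∀ {S} {σ} Γ →
          Infers {S} (sub σ) [ Γ ] (map (substF σ) Γ)
  TC₀   : ∀ {S} {A s t} Γ →
          Infers {S} (TC₀ A s t) [ A ⟨ s , t ⟩ ∷ Γ ] (TC A s t ∷ Γ)
  TC₁   : ∀ {S} {A s r t} Γ →
          Infers {S} (TC₁ A s r t)
            ((A ⟨ s , r ⟩ ∷ Γ) ∷ (TC A r t ∷ Γ) ∷ []) (TC A s t ∷ Γ)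
  coTCᵣ : ∀ {S} {A s t c} Γ → All (Fresh c) (coTC A s t ∷ Γ) →
          Infers {S} (coTCᵣ A s t c)
            ((A ⟨ s , t ⟩ ∷ Γ) ∷ (A ⟨ s , const c ⟩ ∷ coTC A (const c) t ∷ Γ) ∷ [])
            (coTC A s t ∷ Γ)
  cut   : ∀ {A} Γ →
          Infers (cut A) ((A ∷ Γ) ∷ (complement A ∷ Γ) ∷ []) Γ

-- A node of a preproof: the conclusion of an inference step and its rule.
record Node (S : System) : Set where
  constructor node
  field
    sequent : Sequent
    rule    : Rule S
open Node public

-- Equality of rules, with substitutions compared extensionally.
data _≈ᴿ_ {S} : Rule S → Rule S → Set where
  same : ∀ {r} → r ≈ᴿ r
  sub  : ∀ {σ τ} → (∀ c → onConst σ c ≡ onConst τ c) →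
         (∀ k f → onFun σ k f ≡ onFun τ k f) → sub σ ≈ᴿ sub τ

_≈ᴺ_ : ∀ {S} → Node S → Node S → Set
m ≈ᴺ n = sequent m ∼[ set ] sequent n × rule m ≈ᴿ rule n

Address : Set
Address = List ℕ

-- A possibly infinite tree is a labelling of a prefix-closed set of addresses
-- (paths from the root; the i-th premiss of the node at u is at u ∷ʳ i), with
-- nothing at the addresses outside the tree.
record Preproof (S : System) : Set where
  field
    label  : Address → Maybe (Node S)
    root   : Is-just (label [])
    step   : ∀ u n → label u ≡ just n →
             ∃[ Δs ] ∃[ Γ ] Infers (rule n) Δs Γ × Γ ∼[ set ] sequent n ×
               (∀ i → Pointwise (λ Δ m → Δ ∼[ set ] sequent m)
                        (head (drop i Δs)) (label (u ∷ʳ i)))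
    closed : ∀ u → label u ≡ nothing → ∀ i → label (u ∷ʳ i) ≡ nothing
open Preproof public

Proves : ∀ {S} → Preproof S → Sequent → Set
Proves D Γ = ∃[ n ] label D [] ≡ just n × sequent n ∼[ set ] Γ

SameSubtree : ∀ {S} → Preproof S → Address → Address → Set
SameSubtree D u v = ∀ w → Pointwise _≈ᴺ_ (label D (u ++ w)) (label D (v ++ w))

Regular : ∀ {S} → Preproof S → Set
Regular D = Σ[ vs ∈ List Address ]
  (∀ u → Is-just (label D u) → Any (SameSubtree D u) vs)

prefix : (ℕ → ℕ) → ℕ → Address
prefix d zero    = []
prefix d (suc i) = prefix d i ∷ʳ d i

record Branch {S} (D : Preproof S) : Set where
  field
    direction : ℕ → ℕ
    at        : ℕ → Node S
    on        : ∀ i → label D (prefix direction i) ≡ just (at i)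
open Branch public

IsSub : ∀ {S} → Rule S → Set
IsSub (sub σ) = ⊤
IsSub _       = ⊥

Stay : ∀ {S} → Rule S → (s t s′ t′ : Term 0) → Set
Stay r s t s′ t′ = ¬ IsSub r × s′ ≡ s × t′ ≡ t

Unfold : ∀ {S} → Formula 2 → Rule S → (s t s′ t′ : Term 0) → Set
Unfold A r s t s′ t′ = ∃[ c ] r ≡ coTCᵣ A s t c × s′ ≡ const c × t′ ≡ t

Rename : ∀ {S} → Rule S → (s t s′ t′ : Term 0) → Set
Rename r s t s′ t′ = ∃[ σ ] r ≡ sub σ × substT σ s′ ≡ s × substT σ t′ ≡ t

-- The values s i and t i are relevant only for i ≥ start.
record Trace {S} {D : Preproof S} (β : Branch D) : Set where
  field
    start  : ℕ
    body   : Formula 2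
    s t    : ℕ → Term 0
    occurs : ∀ i → start ≤ i → coTC body (s i) (t i) ∈ sequent (at β i)
    moves  : ∀ i → start ≤ i →
             Stay (rule (at β i)) (s i) (t i) (s (suc i)) (t (suc i))
             ⊎ Unfold body (rule (at β i)) (s i) (t i) (s (suc i)) (t (suc i))
             ⊎ Rename (rule (at β i)) (s i) (t i) (s (suc i)) (t (suc i))

Progressing : ∀ {S} {D : Preproof S} {β : Branch D} → Trace β → Set
Progressing {β = β} T = ∀ n → ∃[ i ] n ≤ i × start ≤ i ×
    Unfold body (rule (at β i)) (s i) (t i) (s (suc i)) (t (suc i))
  where open Trace T

-- The trace exists in the classical sense (¬ ¬): which trace a branch ends up
-- following, and from where, depends on its whole infinite course, so it
-- cannot in general be computed from the branch.
IsProof : ∀ {S} → Preproof S → Set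
IsProof D = (β : Branch D) → ¬ ¬ (Σ[ T ∈ Trace β ] Progressing T)

HasCyclicProof : System → Sequent → Set
HasCyclicProof S Γ = Σ[ D ∈ Preproof S ] Proves D Γ × IsProof D × Regular D

{-# OPTIONS --safe #-}
module Submission where

-- The sequent says that a path from c to d yields a path from d to c in the
-- converse relation:  coTC(ā(x,y))(c,d), TC(a(y,x))(d,c).
--
-- With cut, unfold the first formula to ā(c,e), coTC(ā)(e,d) and cut on
-- TC(a⁻)(d,e): one premiss is an instance of the sequent, the other one says
-- that TC(a⁻) can be extended at its right end, by a second induction.
--
-- Without cut, only the two fixed-point formulas and atoms over a ever occur, and
-- TC(a⁻)(d,c) can only be used once all the edges of a path from c to d are
-- present.  Follow the branch that keeps unfolding coTC formulas to the right as
-- long as their left end is connected to c.  A regular preproof has finitely many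
-- formulas, so a path longer than their number must lack an edge in the current
-- sequent; the part beyond the gap is then useless and may be given a finite
-- length.  Hence along every trace the height of the left end grows with each
-- unfolding but stays bounded, so that no trace on the branch is progressing.

open import Data.Empty using (⊥; ⊥-elim)
open import Data.Fin.Base using (Fin; zero; suc; toℕ)
open import Data.Fin.Patterns
open import Data.Fin.Properties using (all?; ¬∀⟶∃¬; pigeonhole; toℕ-injective; toℕ<n; <⇒≢)
  renaming (_≟_ to _≟F_)
open import Data.List.Base
  using (List; []; _∷_; [_]; _++_; _∷ʳ_; map; head; drop; concatMap; length; lookup; tabulate)
open import Data.List.Membership.DecPropositional using (_∈?_)
open import Data.List.Membership.Propositional using (_∈_; lose)
open import Data.List.Membership.Propositional.Properties
  using (∈-++⁺ˡ; ∈-map⁺; ∈-concatMap⁺; ∈-tabulate⁺)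
open import Data.List.Properties using (++-identityʳ; length-map)
open import Data.List.Relation.Binary.BagAndSetEquality using (_∼[_]_; set; bag-=⇒; ↭⇒∼bag)
open import Data.List.Relation.Binary.Permutation.Propositional
  using (_↭_; ↭-refl; ↭-sym; ↭-prep; ↭-swap)
open import Data.List.Relation.Binary.Permutation.Propositional.Properties using (shift; ++-comm)
open import Data.List.Relation.Unary.All as All using (All; []; _∷_)
open import Data.List.Relation.Unary.Any as Any using (Any; here; there)
open import Data.List.Relation.Unary.Any.Properties using (lookup-index)
open import Data.Maybe as Maybe using (Maybe; just; nothing; maybe′; _>>=_; Is-just)
open import Data.Maybe.Properties using (just-injective; ≡-dec)
open import Data.Maybe.Relation.Binary.Pointwise as Pointwise using (Pointwise; just; nothing)
open import Data.Maybe.Relation.Unary.Any using (just)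
open import Data.Nat.Base
  using (ℕ; zero; suc; _≤_; _<_; _≤′_; ≤′-refl; ≤′-step; _⊔_; z≤n; s≤s; s≤s⁻¹)
open import Data.Nat.Properties
  using (_≟_; _≤?_; ≤-refl; ≤-trans; ≤-reflexive; ≤-antisym; ≤∧≢⇒<; suc-injective;
         m≤n⇒m≤1+n; <⇒≱; ≰⇒>; n≤1+n; 1+n≰n; m≤m⊔n; m≤n⊔m; ≤⇒≤′; ≤′⇒≤)
open import Data.Product.Base using (∃-syntax; Σ-syntax; _×_; _,_; proj₁; proj₂)
open import Data.Sum.Base using (_⊎_; inj₁; inj₂; [_,_]′)
open import Data.Unit.Base using (⊤; tt)
open import Data.Vec.Base as Vec using ([]; _∷_)
open import Function.Base using (_∘_)
open import Function.Bundles using (Equivalence)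
open import Function.Related.Propositional using (K-refl)
open import Relation.Binary.PropositionalEquality
  using (_≡_; _≢_; refl; sym; trans; cong; cong₂; subst; subst₂)
open import Relation.Nullary.Decidable.Core using (Dec; yes; no; from-yes)
open import Relation.Nullary.Negation.Core using (¬_; contradiction)
open import Defs

-- The sequent separating the two systems.

edge̅ edge⁻ : Formula 2
edge̅ = nrel 0 (bound zero) (bound (suc zero))
edge⁻ = rel 0 (bound (suc zero)) (bound zero)

converse : Sequent
converse = coTC edge̅ (const 0) (const 1) ∷ TC edge⁻ (const 1) (const 0) ∷ []

-- Regular preproofs from finite graphs of inferences.

module Unravelling {S m} (nodes : Fin m → Node S) (kids : Fin m → List (Fin m))
  (infers : ∀ q → ∃[ Γ ] Infers (rule (nodes q)) (map (sequent ∘ nodes) (kids q)) Γ ×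
                         Γ ↭ sequent (nodes q))
  (root : Fin m) where

  walk : Fin m → Address → Maybe (Fin m)
  walk q []      = just q
  walk q (i ∷ u) = head (drop i (kids q)) >>= λ r → walk r u

  walk-++ : ∀ q u w → walk q (u ++ w) ≡ (walk q u >>= λ r → walk r w)
  walk-++ q []      w = refl
  walk-++ q (i ∷ u) w with head (drop i (kids q))
  ... | just r  = walk-++ r u w
  ... | nothing = refl

  walk-on : ∀ {q} u w → walk root u ≡ just q → walk root (u ++ w) ≡ walk q w
  walk-on u w eq = trans (walk-++ root u w) (cong (_>>= λ r → walk r w) eq)

  label-walk : Address → Maybe (Node S)
  label-walk = Maybe.map nodes ∘ walk root

  visited : ∀ u {n} → label-walk u ≡ just n → ∃[ q ] walk root u ≡ just q × nodes q ≡ n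
  visited u eq with walk root u
  ... | just q = q , refl , just-injective eq

  premisses : ∀ qs i → Pointwise (λ Δ n → Δ ∼[ set ] sequent n)
    (head (drop i (map (sequent ∘ nodes) qs))) (Maybe.map nodes (head (drop i qs) >>= just))
  premisses []       zero    = nothing
  premisses []       (suc i) = nothing
  premisses (q ∷ qs) zero    = just K-refl
  premisses (q ∷ qs) (suc i) = premisses qs i

  preproof : Preproof S
  preproof = record
    { label = label-walk
    ; root  = just tt
    ; step  = step′
    ; closed = closed′
    }
    where
    step′ : ∀ u n → label-walk u ≡ just n →
      ∃[ Δs ] ∃[ Γ ] Infers (rule n) Δs Γ × Γ ∼[ set ] sequent n ×
        (∀ i → Pointwise (λ Δ m → Δ ∼[ set ] sequent m) (head (drop i Δs)) (label-walk (u ∷ʳ i)))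
    step′ u n eq with visited u eq
    ... | q , at-q , refl with infers q
    ... | Γ , inf , Γ↭ = _ , Γ , inf , bag-=⇒ (↭⇒∼bag Γ↭) ,
      λ i → subst (Pointwise _ _) (cong (Maybe.map nodes) (sym (walk-on u [ i ] at-q)))
              (premisses (kids q) i)

    closed′ : ∀ u → label-walk u ≡ nothing → ∀ i → label-walk (u ∷ʳ i) ≡ nothing
    closed′ u eq i rewrite walk-++ root u [ i ] with walk root u
    ... | nothing = refl

  -- The subtree at an address depends only on the state reached there, so one address per state
  -- represents all subtrees.
  regular : (address : Fin m → Address) → (∀ q → walk root (address q) ≡ just q) →
            Regular preproof
  regular address at = tabulate address , λ u → found u
    where
    found : ∀ u → Is-just (label-walk u) → Any (SameSubtree preproof u) (tabulate address)
    found u isJust with walk root u in eq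
    ... | just q = lose (∈-tabulate⁺ q) λ w →
      subst (Pointwise _≈ᴺ_ (label-walk (u ++ w)))
        (cong (Maybe.map nodes) (trans (walk-on u w eq) (sym (walk-on (address q) w (at q)))))
        (Pointwise.refl ((λ {_} → K-refl) , same))

  -- Every path out of `q` visits at most `k` states, counting `q` itself: a leaf has `k = 1`.
  -- Infinite branches avoid such states.
  Finite : ℕ → Fin m → Set
  Finite zero    q = ⊥
  Finite (suc k) q = All (Finite k) (kids q)

  module Run (β : Branch preproof) where

    visit : ∀ i → ∃[ q ] walk root (prefix (direction β) i) ≡ just q × nodes q ≡ at β i
    visit i = visited (prefix (direction β) i) (on β i)

    state : ℕ → Fin m
    state i = proj₁ (visit i)

    state-node : ∀ i → nodes (state i) ≡ at β i
    state-node i = proj₂ (proj₂ (visit i))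

    child-∈ : ∀ (qs : List (Fin m)) i {r} → (head (drop i qs) >>= just) ≡ just r → r ∈ qs
    child-∈ (q ∷ qs) zero    refl = here refl
    child-∈ (q ∷ qs) (suc i) eq   = there (child-∈ qs i eq)
    child-∈ []       zero    ()
    child-∈ []       (suc i) ()

    follows : ∀ i → state (suc i) ∈ kids (state i)
    follows i = child-∈ (kids (state i)) (direction β i)
      (trans (sym (walk-on (prefix (direction β) i) [ direction β i ] (proj₁ (proj₂ (visit i)))))
             (proj₁ (proj₂ (visit (suc i)))))

    infinite : ∀ k i → ¬ Finite k (state i)
    infinite (suc k) i fin = infinite k (suc i) (All.lookup fin (follows i))

-- The cyclic proof with cut.

pattern 10F = suc 9F
pattern 11F = suc 10F
pattern 12F = suc 11F
pattern 13F = suc 12F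
pattern 14F = suc 13F
pattern 15F = suc 14F

a̅ a₊ : Term 0 → Term 0 → Formula 0
a̅ = nrel 0
a₊ = rel 0

edge̅⁻ : Formula 2
edge̅⁻ = complement edge⁻

reach̅ reach⁻ reach̅⁻ : Term 0 → Term 0 → Formula 0
reach̅  = coTC edge̅
reach⁻  = TC edge⁻
reach̅⁻ = coTC edge̅⁻

c d e f : Term 0
c = const 0
d = const 1
e = const 2
f = const 3

-- Both back links are renamings: `c` to `e` takes the root to node 5, and `d` to `f` takes node 7
-- to node 15.
replaceConst : ℕ → ℕ → Subst
onConst (replaceConst x y) z with z ≟ x
... | yes _ = const y
... | no _  = const z
onFun (replaceConst x y) _ g = g

-- Node 3 cuts on TC(d, e), which node 4 closes by a copy of the root and node 6
-- by the right-recursion for TC(a⁻), itself proved by the cycle 7, 12, 14, 15.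
proofNode : Fin 16 → Node TCG+cut
proofNode 0F  = node (reach̅ c d ∷ reach⁻ d c ∷ [])                       (coTCᵣ edge̅ c d 2)
proofNode 1F  = node (a̅ c d ∷ reach⁻ d c ∷ [])                           (TC₀ edge⁻ d c)
proofNode 2F  = node (a₊ c d ∷ a̅ c d ∷ [])                               (id₂ 0 c d)
proofNode 3F  = node (a̅ c e ∷ reach̅ e d ∷ reach⁻ d c ∷ [])               (cut (reach⁻ d e))
proofNode 4F  = node (reach⁻ d e ∷ a̅ c e ∷ reach̅ e d ∷ reach⁻ d c ∷ [])  wk
proofNode 5F  = node (reach̅ e d ∷ reach⁻ d e ∷ [])                       (sub (replaceConst 0 2))
proofNode 6F  = node (reach̅⁻ d e ∷ a̅ c e ∷ reach̅ e d ∷ reach⁻ d c ∷ []) wk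
proofNode 7F  = node (reach̅⁻ d e ∷ a̅ c e ∷ reach⁻ d c ∷ [])              (coTCᵣ edge̅⁻ d e 3)
proofNode 8F  = node (a̅ e d ∷ a̅ c e ∷ reach⁻ d c ∷ [])                   (TC₁ edge⁻ d e c)
proofNode 9F  = node (a₊ e d ∷ a̅ e d ∷ a̅ c e ∷ [])                       (id₂ 0 e d)
proofNode 10F = node (reach⁻ e c ∷ a̅ e d ∷ a̅ c e ∷ [])                   (TC₀ edge⁻ e c)
proofNode 11F = node (a₊ c e ∷ a̅ e d ∷ a̅ c e ∷ [])                       (id₂ 0 c e)
proofNode 12F = node (a̅ f d ∷ reach̅⁻ f e ∷ a̅ c e ∷ reach⁻ d c ∷ [])      (TC₁ edge⁻ d f c)
proofNode 13F = node (a₊ f d ∷ a̅ f d ∷ reach̅⁻ f e ∷ a̅ c e ∷ [])          (id₂ 0 f d)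
proofNode 14F = node (reach⁻ f c ∷ a̅ f d ∷ reach̅⁻ f e ∷ a̅ c e ∷ [])      wk
proofNode 15F = node (reach̅⁻ f e ∷ a̅ c e ∷ reach⁻ f c ∷ [])              (sub (replaceConst 1 3))

proofKids : Fin 16 → List (Fin 16)
proofKids 0F  = 1F ∷ 3F ∷ []
proofKids 1F  = 2F ∷ []
proofKids 2F  = []
proofKids 3F  = 4F ∷ 6F ∷ []
proofKids 4F  = 5F ∷ []
proofKids 5F  = 0F ∷ []
proofKids 6F  = 7F ∷ []
proofKids 7F  = 8F ∷ 12F ∷ []
proofKids 8F  = 9F ∷ 10F ∷ []
proofKids 9F  = []
proofKids 10F = 11F ∷ []
proofKids 11F = []
proofKids 12F = 13F ∷ 14F ∷ []
proofKids 13F = []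
proofKids 14F = 15F ∷ []
proofKids 15F = 7F ∷ []

proofInfers : ∀ q → ∃[ Γ ]
  Infers (rule (proofNode q)) (map (sequent ∘ proofNode) (proofKids q)) Γ ×
  Γ ↭ sequent (proofNode q)
proofInfers 0F  = _ , coTCᵣ _ (((tt , tt) , (λ ()) , (λ ())) ∷
                               ((tt , tt) , (λ ()) , (λ ())) ∷ []) , ↭-refl
proofInfers 1F  = _ , TC₀ _ , ↭-swap _ _ ↭-refl
proofInfers 2F  = _ , id₂ _ , ↭-refl
proofInfers 3F  = _ , cut _ , ↭-refl
proofInfers 4F  = _ , wk _ (a̅ c e ∷ reach⁻ d c ∷ []) , ↭-sym (shift _ (_ ∷ _ ∷ []) _)
proofInfers 5F  = _ , sub _ , ↭-refl
proofInfers 6F  = _ , wk _ (reach̅ e d ∷ []) , ↭-prep _ (↭-prep _ (↭-swap _ _ ↭-refl))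
proofInfers 7F  = _ , coTCᵣ _ (((tt , tt) , (λ ()) , (λ ())) ∷ ((λ ()) , (λ ())) ∷
                               ((tt , tt) , (λ ()) , (λ ())) ∷ []) , ↭-refl
proofInfers 8F  = _ , TC₁ _ , ↭-sym (shift _ (_ ∷ _ ∷ []) [])
proofInfers 9F  = _ , id₂ _ , ↭-refl
proofInfers 10F = _ , TC₀ _ , ↭-refl
proofInfers 11F = _ , id₂ _ , ↭-prep _ (↭-swap _ _ ↭-refl)
proofInfers 12F = _ , TC₁ _ , ↭-sym (shift _ (_ ∷ _ ∷ _ ∷ []) [])
proofInfers 13F = _ , id₂ _ , ↭-refl
proofInfers 14F = _ , wk _ (a̅ f d ∷ []) , ++-comm (_ ∷ _ ∷ []) (_ ∷ _ ∷ [])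
proofInfers 15F = _ , sub _ , ↭-refl

open Unravelling proofNode proofKids proofInfers 0F

-- Progressing traces along the two cycles.

data Cycle : Set where
  outer inner : Cycle

-- The argument of type Fin 4 counts the steps left until the tracked formula is
-- unfolded.
on-cycle : Cycle → Fin 4 → Fin 16
on-cycle outer 0F = 0F
on-cycle outer 3F = 3F
on-cycle outer 2F = 4F
on-cycle outer 1F = 5F
on-cycle inner 0F = 7F
on-cycle inner 3F = 12F
on-cycle inner 2F = 14F
on-cycle inner 1F = 15F

next : Fin 4 → Fin 4
next 0F = 3F
next 3F = 2F
next 2F = 1F
next 1F = 0F

tracked-body : Cycle → Formula 2
tracked-body outer = edge̅
tracked-body inner = edge̅⁻

tracked-target : Cycle → Term 0
tracked-target outer = d
tracked-target inner = e

tracked-source : Fin 16 → Term 0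
tracked-source 0F = c
tracked-source 7F = d
tracked-source 3F = e
tracked-source 4F = e
tracked-source 5F = e
-- Meant for nodes 12, 14 and 15; a default value off the cycles.
tracked-source _  = f

tracked-occurs : ∀ z p →
  coTC (tracked-body z) (tracked-source (on-cycle z p)) (tracked-target z)
    ∈ sequent (proofNode (on-cycle z p))
tracked-occurs outer 0F = here refl
tracked-occurs outer 3F = there (here refl)
tracked-occurs outer 2F = there (there (here refl))
tracked-occurs outer 1F = here refl
tracked-occurs inner 0F = here refl
tracked-occurs inner 3F = there (here refl)
tracked-occurs inner 2F = there (there (here refl))
tracked-occurs inner 1F = here refl

Moves : Formula 2 → Rule TCG+cut → (s t s′ t′ : Term 0) → Set
Moves A r s t s′ t′ = Stay r s t s′ t′ ⊎ Unfold A r s t s′ t′ ⊎ Rename r s t s′ t′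

tracked-moves : ∀ z p →
  Moves (tracked-body z) (rule (proofNode (on-cycle z p)))
    (tracked-source (on-cycle z p)) (tracked-target z)
    (tracked-source (on-cycle z (next p))) (tracked-target z)
tracked-moves outer 0F = inj₂ (inj₁ (_ , refl , refl , refl))
tracked-moves outer 3F = inj₁ ((λ ()) , refl , refl)
tracked-moves outer 2F = inj₁ ((λ ()) , refl , refl)
tracked-moves outer 1F = inj₂ (inj₂ (_ , refl , refl , refl))
tracked-moves inner 0F = inj₂ (inj₁ (_ , refl , refl , refl))
tracked-moves inner 3F = inj₁ ((λ ()) , refl , refl)
tracked-moves inner 2F = inj₁ ((λ ()) , refl , refl)
tracked-moves inner 1F = inj₂ (inj₂ (_ , refl , refl , refl))

tracked-unfolds : ∀ z →
  Unfold (tracked-body z) (rule (proofNode (on-cycle z 0F)))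
    (tracked-source (on-cycle z 0F)) (tracked-target z)
    (tracked-source (on-cycle z (next 0F))) (tracked-target z)
tracked-unfolds outer = _ , refl , refl , refl
tracked-unfolds inner = _ , refl , refl , refl

module _ (β : Branch preproof) where
  open Run β

  module Eventually (z : Cycle) (k : ℕ) (p₀ : Fin 4) (enters : state k ≡ on-cycle z p₀)
    (stays : ∀ i p → state i ≡ on-cycle z p → state (suc i) ≡ on-cycle z (next p)) where

    phase : ∀ {i} → k ≤′ i → ∃[ p ] state i ≡ on-cycle z p
    phase         ≤′-refl       = p₀ , enters
    phase {suc i} (≤′-step k≤i) = let p , eq = phase k≤i in next p , stays i p eq

    -- Carries a fact checked once on the finite graph over to step `i` of the branch.
    along : (P : Fin 16 → Node TCG+cut → Fin 16 → Set) → ∀ i p → state i ≡ on-cycle z p →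
            P (on-cycle z p) (proofNode (on-cycle z p)) (on-cycle z (next p)) →
            P (state i) (at β i) (state (suc i))
    along P i p eq holds =
      subst (λ n → P (state i) n (state (suc i))) (state-node i)
        (subst₂ (λ q q′ → P q (proofNode q) q′) (sym eq) (sym (stays i p eq)) holds)

    trace : Trace β
    trace = record
      { start  = k
      ; body   = tracked-body z
      ; s      = tracked-source ∘ state
      ; t      = λ _ → tracked-target z
      ; occurs = λ i k≤i → let p , eq = phase (≤⇒≤′ k≤i) in
          along (λ q n _ → coTC (tracked-body z) (tracked-source q) (tracked-target z) ∈ sequent n)
            i p eq (tracked-occurs z p)
      ; moves  = λ i k≤i → let p , eq = phase (≤⇒≤′ k≤i) in
          along (λ q n q′ → Moves (tracked-body z) (rule n) (tracked-source q) (tracked-target z)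
                              (tracked-source q′) (tracked-target z))
            i p eq (tracked-moves z p)
      }

    unfolds-after : ∀ i p → state i ≡ on-cycle z p → ∃[ j ] i ≤ j × state j ≡ on-cycle z 0F
    unfolds-after i 0F eq = i , ≤-refl , eq
    unfolds-after i 1F eq = suc i , n≤1+n i , stays i 1F eq
    unfolds-after i 2F eq with unfolds-after (suc i) 1F (stays i 2F eq)
    ... | j , i<j , at-0 = j , ≤-trans (n≤1+n i) i<j , at-0
    unfolds-after i 3F eq with unfolds-after (suc i) 2F (stays i 3F eq)
    ... | j , i<j , at-0 = j , ≤-trans (n≤1+n i) i<j , at-0

    progressing : Progressing trace
    progressing n =
      let p , eq = phase (≤⇒≤′ (m≤n⊔m n k))
          j , n⊔k≤j , at-0 = unfolds-after (n ⊔ k) p eq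
      in j , ≤-trans (m≤m⊔n n k) n⊔k≤j , ≤-trans (m≤n⊔m n k) n⊔k≤j ,
         along (λ q n q′ → Unfold (tracked-body z) (rule n) (tracked-source q) (tracked-target z)
                             (tracked-source q′) (tracked-target z))
           j 0F at-0 (tracked-unfolds z)

  leaves : ∀ i {x} → state i ≡ x → state (suc i) ∈ proofKids x
  leaves i refl = follows i

  not-finite : ∀ i k {x} → Finite k x → ¬ (state i ≡ x)
  not-finite i k fin refl = infinite k i fin

  -- The kids that leave the inner cycle, nodes 8 and 13, root finite subtrees, where no infinite
  -- branch can go.
  stays-inner : ∀ i p → state i ≡ on-cycle inner p → state (suc i) ≡ on-cycle inner (next p)
  stays-inner i 0F eq with leaves i eq
  ... | here eq′         = ⊥-elim (not-finite (suc i) 3 ([] ∷ ([] ∷ []) ∷ []) eq′)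
  ... | there (here eq′) = eq′
  stays-inner i 1F eq with leaves i eq
  ... | here eq′         = eq′
  stays-inner i 2F eq with leaves i eq
  ... | here eq′         = eq′
  stays-inner i 3F eq with leaves i eq
  ... | here eq′         = ⊥-elim (not-finite (suc i) 1 [] eq′)
  ... | there (here eq′) = eq′

  -- Apart from the finite subtree at node 1, the only exit leads through node 6, whose single kid
  -- is node 7.
  stays-outer : (∀ i → state i ≢ 7F) →
                ∀ i p → state i ≡ on-cycle outer p → state (suc i) ≡ on-cycle outer (next p)
  stays-outer never i 0F eq with leaves i eq
  ... | here eq′         = ⊥-elim (not-finite (suc i) 2 ([] ∷ []) eq′)
  ... | there (here eq′) = eq′
  stays-outer never i 1F eq with leaves i eq
  ... | here eq′         = eq′
  stays-outer never i 2F eq with leaves i eq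
  ... | here eq′         = eq′
  stays-outer never i 3F eq with leaves i eq
  ... | here eq′         = eq′
  ... | there (here eq′) with leaves (suc i) eq′
  ...   | here eq″       = ⊥-elim (never (suc (suc i)) eq″)

  -- A branch either enters the inner cycle and never leaves it, or stays on the
  -- outer one forever.
  progressing-trace : ¬ ¬ (Σ[ T ∈ Trace β ] Progressing T)
  progressing-trace none = none (trace , progressing)
    where
    never : ∀ i → state i ≢ 7F
    never i eq = none (Eventually.trace inner i 0F eq stays-inner ,
                       Eventually.progressing inner i 0F eq stays-inner)
    open Eventually outer 0 0F refl (stays-outer never)

-- The address at which each node is reached without following a back link.
nodeAddress : Fin 16 → Address
nodeAddress = Vec.lookup
  ( [] ∷ (0 ∷ []) ∷ (0 ∷ 0 ∷ []) ∷ (1 ∷ []) ∷ (1 ∷ 0 ∷ []) ∷ (1 ∷ 0 ∷ 0 ∷ [])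
  ∷ (1 ∷ 1 ∷ []) ∷ (1 ∷ 1 ∷ 0 ∷ []) ∷ (1 ∷ 1 ∷ 0 ∷ 0 ∷ []) ∷ (1 ∷ 1 ∷ 0 ∷ 0 ∷ 0 ∷ [])
  ∷ (1 ∷ 1 ∷ 0 ∷ 0 ∷ 1 ∷ []) ∷ (1 ∷ 1 ∷ 0 ∷ 0 ∷ 1 ∷ 0 ∷ []) ∷ (1 ∷ 1 ∷ 0 ∷ 1 ∷ [])
  ∷ (1 ∷ 1 ∷ 0 ∷ 1 ∷ 0 ∷ []) ∷ (1 ∷ 1 ∷ 0 ∷ 1 ∷ 1 ∷ []) ∷ (1 ∷ 1 ∷ 0 ∷ 1 ∷ 1 ∷ 0 ∷ []) ∷ [] )

cyclic-proof : HasCyclicProof TCG+cut converse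
cyclic-proof = preproof , (proofNode 0F , refl , λ {_} → K-refl) , progressing-trace ,
  regular nodeAddress (from-yes (all? λ q → ≡-dec _≟F_ (walk 0F (nodeAddress q)) (just q)))

-- Points, valuations and detaching.

-- By pigeonhole, since there are `suc (length xs)` candidates. It later supplies a height at which
-- no edge formula of the proof starts.
avoid : (xs : List ℕ) → ∃[ j ] j ≤ length xs × ¬ (j ∈ xs)
avoid xs =
  let j , j∉xs = ¬∀⟶∃¬ (suc (length xs)) _ (λ j → _∈?_ _≟_ (toℕ j) xs) covered
  in toℕ j , s≤s⁻¹ (toℕ<n j) , j∉xs
  where
  covered : ¬ (∀ (j : Fin (suc (length xs))) → toℕ j ∈ xs)
  covered mem with pigeonhole ≤-refl (Any.index ∘ mem)
  ... | i , j , i<j , same-index = <⇒≢ i<j (toℕ-injective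
    (trans (lookup-index (mem i))
      (trans (cong (lookup xs) same-index) (sym (lookup-index (mem j))))))

-- The points pt 0 n form the path from the source, which never reaches the target
-- ∞; the chains of generation g > 0 are disconnected from it and do reach ∞.
data Point : Set where
  ∞  : Point
  pt : (gen height : ℕ) → Point

height : Point → ℕ
-- A default value: the left end of an open `coTC` formula is never `∞`.
height ∞        = 0
height (pt _ n) = n

Valuation : Set
Valuation = ℕ → Point

-- Substitutions keep free variables free and compound terms compound, so sending all of these to
-- `∞` makes the value depend on the constants alone and commute with substitution.
⟦_⟧ : Term 0 → Valuation → Point
⟦ free _ ⟧          ρ = ∞
⟦ fun zero c _ ⟧    ρ = ρ c
⟦ fun (suc _) _ _ ⟧ ρ = ∞

_[_↦_] : Valuation → ℕ → Point → Valuation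
(ρ [ c ↦ v ]) d with d ≟ c
... | yes _ = v
... | no _  = ρ d

update-≡ : ∀ ρ c v → (ρ [ c ↦ v ]) c ≡ v
update-≡ ρ c v with c ≟ c
... | yes _  = refl
... | no c≢c = contradiction refl c≢c

update-≢ : ∀ ρ {c d} v → d ≢ c → (ρ [ c ↦ v ]) d ≡ ρ d
update-≢ ρ {c} {d} v d≢c with d ≟ c
... | yes d≡c = contradiction d≡c d≢c
... | no _    = refl

⟦⟧-update : ∀ {ρ c v} t → FreshT c t → ⟦ t ⟧ (ρ [ c ↦ v ]) ≡ ⟦ t ⟧ ρ
⟦⟧-update         (free _)          _  = refl
⟦⟧-update {ρ} {v = v} (fun zero _ _) fr = update-≢ ρ v fr
⟦⟧-update         (fun (suc _) _ _) _  = refl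

⟦⟧-closed : ∀ ρ (t : Term 0) → ⟦ instT (λ ()) t ⟧ ρ ≡ ⟦ t ⟧ ρ
⟦⟧-closed ρ (free _)          = refl
⟦⟧-closed ρ (fun zero _ _)    = refl
⟦⟧-closed ρ (fun (suc _) _ _) = refl

_∘ₛ_ : Valuation → Subst → Valuation
(ρ ∘ₛ σ) c = ⟦ onConst σ c ⟧ ρ

⟦⟧-subst : ∀ ρ σ t → ⟦ substT σ t ⟧ ρ ≡ ⟦ t ⟧ (ρ ∘ₛ σ)
⟦⟧-subst ρ σ (free _)          = refl
⟦⟧-subst ρ σ (fun zero c _)    = ⟦⟧-closed ρ (onConst σ c)
⟦⟧-subst ρ σ (fun (suc _) _ _) = refl

-- Constants go to closed terms, so no substitution creates a bound variable. Hence only `edge̅` and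
-- `edge⁻` themselves are mapped to `edge̅` and `edge⁻`.
substT-bound : ∀ {n} σ (t : Term n) {i} → substT σ t ≡ bound i → t ≡ bound i
substT-bound σ (bound _)      eq = eq
substT-bound σ (fun zero c _) eq with onConst σ c
substT-bound σ (fun zero c _) () | free _
substT-bound σ (fun zero c _) () | fun _ _ _

substF-edge̅ : ∀ σ A → substF σ A ≡ edge̅ → A ≡ edge̅
substF-edge̅ σ (nrel a s t) eq with substT σ s in eqs | substT σ t in eqt
substF-edge̅ σ (nrel _ s t) refl | _ | _ =
  cong₂ (nrel 0) (substT-bound σ s eqs) (substT-bound σ t eqt)

substF-edge⁻ : ∀ σ A → substF σ A ≡ edge⁻ → A ≡ edge⁻
substF-edge⁻ σ (rel a s t) eq with substT σ s in eqs | substT σ t in eqt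
substF-edge⁻ σ (rel _ s t) refl | _ | _ =
  cong₂ (rel 0) (substT-bound σ s eqs) (substT-bound σ t eqt)

-- The points off chain 0, which no path of edges from `pt 0 0` reaches.
Stuck : Point → Set
Stuck ∞              = ⊤
Stuck (pt zero _)    = ⊥
Stuck (pt (suc _) _) = ⊤

-- Removing the edge out of pt 0 j turns the part of chain 0 beyond it into a
-- chain of generation 1; the other generations are shifted to make room.
isolate : ℕ → ℕ → ℕ → ℕ
isolate j (suc g) n = suc (suc g)
isolate j zero    n with n ≤? j
... | yes _ = 0
... | no _  = 1

detach : ℕ → Point → Point
detach j ∞        = ∞
detach j (pt g n) = pt (isolate j g n) n

detach-low : ∀ {j n} → n ≤ j → detach j (pt 0 n) ≡ pt 0 n
detach-low {j} {n} n≤j with n ≤? j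
... | yes _  = refl
... | no n≰j = contradiction n≤j n≰j

detach-high : ∀ {j n} → j < n → detach j (pt 0 n) ≡ pt 1 n
detach-high {j} {n} j<n with n ≤? j
... | yes n≤j = contradiction n≤j (<⇒≱ j<n)
... | no _    = refl

detach-low⁻¹ : ∀ {j n} v → detach j v ≡ pt 0 n → n ≤ j
detach-low⁻¹ {j} (pt zero n) eq with n ≤? j
detach-low⁻¹ (pt zero n) refl | yes n≤j = n≤j
detach-low⁻¹ (pt zero n) ()   | no _

height-detach : ∀ j v → height (detach j v) ≡ height v
height-detach j ∞        = refl
height-detach j (pt _ _) = refl

⟦⟧-detach : ∀ j ρ t → ⟦ t ⟧ (detach j ∘ ρ) ≡ detach j (⟦ t ⟧ ρ)
⟦⟧-detach j ρ (free _)          = refl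
⟦⟧-detach j ρ (fun zero _ _)    = refl
⟦⟧-detach j ρ (fun (suc _) _ _) = refl

-- Choosing a premiss for each cut-free rule.

module Game (L : ℕ) where

  -- The exits to `∞` sit at height `suc L`: unfolding on chain 0 goes up to height `L`, and the
  -- step after that is made on a detached chain.
  Edge : Point → Point → Set
  Edge ∞              _         = ⊥
  Edge (pt g n)       (pt h m)  = g ≡ h × suc n ≡ m
  Edge (pt zero _)    ∞         = ⊥
  Edge (pt (suc _) n) ∞         = n ≡ suc L

  edge? : ∀ v w → Dec (Edge v w)
  edge? ∞              w        = no λ ()
  edge? (pt zero _)    ∞        = no λ ()
  edge? (pt (suc _) n) ∞        = n ≟ suc L
  edge? (pt g n)       (pt h m) with g ≟ h | suc n ≟ m
  ... | yes p | yes q = yes (p , q)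
  ... | no ¬p | _     = no (¬p ∘ proj₁)
  ... | yes _ | no ¬q = no (¬q ∘ proj₂)

  -- The edge out of `pt 0 j` is the only one destroyed.
  detach-edge : ∀ {j} v w → v ≢ pt 0 j → Edge v w → Edge (detach j v) (detach j w)
  detach-edge (pt (suc _) n) ∞              _    e            = e
  detach-edge {j} (pt zero n) (pt _ m) v≢ (refl , refl) with n ≤? j | suc n ≤? j
  ... | yes _   | yes _    = refl , refl
  ... | yes n≤j | no n≮j   = contradiction (cong (pt 0) (≤-antisym n≤j (s≤s⁻¹ (≰⇒> n≮j)))) v≢
  ... | no n≰j  | yes n<j  = contradiction (≤-trans (n≤1+n n) n<j) n≰j
  ... | no _    | no _     = refl , refl
  detach-edge (pt (suc g) n) (pt _ _) _ (refl , refl) = refl , refl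

  -- The new chain gets generation 1, which `isolate` has vacated, so it merges with no other; the
  -- only edge it can gain is its exit to `∞`.
  detach-edge⁻¹ : ∀ {j} v w → v ≢ pt 0 (suc L) → Edge (detach j v) (detach j w) → Edge v w
  detach-edge⁻¹ (pt zero n)    (pt zero m)    _ (_ , q) = refl , q
  detach-edge⁻¹ (pt (suc g) n) (pt (suc h) m) _ (p , q) = suc-injective p , q
  detach-edge⁻¹ {j} (pt zero n) (pt (suc h) m) _ (p , _) with n ≤? j
  detach-edge⁻¹ (pt zero n) (pt (suc h) m) _ (() , _) | yes _
  detach-edge⁻¹ (pt zero n) (pt (suc h) m) _ (() , _) | no _
  detach-edge⁻¹ {j} (pt (suc g) n) (pt zero m) _ (p , _) with m ≤? j
  detach-edge⁻¹ (pt (suc g) n) (pt zero m) _ (() , _) | yes _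
  detach-edge⁻¹ (pt (suc g) n) (pt zero m) _ (() , _) | no _
  detach-edge⁻¹ {j} (pt zero n) ∞ v≢ e with n ≤? j
  detach-edge⁻¹ (pt zero n) ∞ v≢ () | yes _
  detach-edge⁻¹ (pt zero n) ∞ v≢ refl | no _ = v≢ refl
  detach-edge⁻¹ (pt (suc g) n) ∞ _ e = e

  Below : Point → Set
  Below ∞        = ⊥
  Below (pt _ n) = n ≤ suc L

  Below-height : ∀ v → Below v → height v ≤ suc L
  Below-height (pt _ _) n≤ = n≤

  detach-Below : ∀ j v → Below v → Below (detach j v)
  detach-Below j (pt _ _) n≤ = n≤

  detach-Stuck : ∀ j v → Stuck v → Stuck (detach j v)
  detach-Stuck j ∞              _ = tt
  detach-Stuck j (pt (suc _) _) _ = tt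

  -- All relation symbols are interpreted by Edge.  The formula coTC(s, ∞) with s
  -- on chain 0 is open although it holds there: it is unfolded forever.
  Open : Valuation → Formula 0 → Set
  Open ρ (rel _ s t)  = ¬ Edge (⟦ s ⟧ ρ) (⟦ t ⟧ ρ)
  Open ρ (nrel _ s t) = Edge (⟦ s ⟧ ρ) (⟦ t ⟧ ρ)
  Open ρ (TC A s t)   = A ≡ edge⁻ × Stuck (⟦ s ⟧ ρ) × ⟦ t ⟧ ρ ≡ pt 0 0
  Open ρ (coTC A s t) = A ≡ edge̅ × Below (⟦ s ⟧ ρ) × ⟦ t ⟧ ρ ≡ ∞
  Open ρ _            = ⊥

  AllOpen : Valuation → Sequent → Set
  AllOpen ρ Γ = ∀ {F} → F ∈ Γ → Open ρ F

  infixr 5 _◂_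
  _◂_ : ∀ {ρ F Γ} → Open ρ F → AllOpen ρ Γ → AllOpen ρ (F ∷ Γ)
  (o ◂ os) (here refl) = o
  (o ◂ os) (there F∈)  = os F∈

  Open-update : ∀ {ρ c v} F → Fresh c F → Open ρ F → Open (ρ [ c ↦ v ]) F
  Open-update {ρ} {c} {v} (rel _ s t) (fs , ft) o
    rewrite ⟦⟧-update {ρ} {c} {v} s fs | ⟦⟧-update {ρ} {c} {v} t ft = o
  Open-update {ρ} {c} {v} (nrel _ s t) (fs , ft) o
    rewrite ⟦⟧-update {ρ} {c} {v} s fs | ⟦⟧-update {ρ} {c} {v} t ft = o
  Open-update {ρ} {c} {v} (TC _ s t) (_ , fs , ft) o
    rewrite ⟦⟧-update {ρ} {c} {v} s fs | ⟦⟧-update {ρ} {c} {v} t ft = o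
  Open-update {ρ} {c} {v} (coTC _ s t) (_ , fs , ft) o
    rewrite ⟦⟧-update {ρ} {c} {v} s fs | ⟦⟧-update {ρ} {c} {v} t ft = o

  Open-subst : ∀ {ρ} σ F → Open ρ (substF σ F) → Open (ρ ∘ₛ σ) F
  Open-subst {ρ} σ (rel _ s t) o rewrite ⟦⟧-subst ρ σ s | ⟦⟧-subst ρ σ t = o
  Open-subst {ρ} σ (nrel _ s t) o rewrite ⟦⟧-subst ρ σ s | ⟦⟧-subst ρ σ t = o
  Open-subst {ρ} σ (TC A s t) (eq , o) rewrite ⟦⟧-subst ρ σ s | ⟦⟧-subst ρ σ t =
    substF-edge⁻ σ A eq , o
  Open-subst {ρ} σ (coTC A s t) (eq , o) rewrite ⟦⟧-subst ρ σ s | ⟦⟧-subst ρ σ t =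
    substF-edge̅ σ A eq , o

  -- Once detached, a point pt 0 (suc L) would gain an edge to ∞.
  Safe : Valuation → Set
  Safe ρ = ∀ c → ρ c ≢ pt 0 (suc L)

  Safe-⟦⟧ : ∀ {ρ} → Safe ρ → ∀ t → ⟦ t ⟧ ρ ≢ pt 0 (suc L)
  Safe-⟦⟧ safe (fun zero c _) = safe c

  Safe-update : ∀ {ρ} c {v} → Safe ρ → v ≢ pt 0 (suc L) → Safe (ρ [ c ↦ v ])
  Safe-update c safe v≢ d with d ≟ c
  ... | yes _ = v≢
  ... | no _  = safe d

  -- 0 is a junk value for formulas other than nrel.
  source : Valuation → Formula 0 → ℕ
  source ρ (nrel _ s _) = height (⟦ s ⟧ ρ)
  source ρ _            = 0

  -- An `nrel` formula keeps its edge because it does not start at height `j`, a `rel` formula gains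
  -- none by safety, `pt 0 0` stays on chain 0, and heights do not change.
  Open-detach : ∀ {ρ} j → Safe ρ → ∀ F → source ρ F ≢ j → Open ρ F → Open (detach j ∘ ρ) F
  Open-detach {ρ} j safe (rel _ s t) _ o
    rewrite ⟦⟧-detach j ρ s | ⟦⟧-detach j ρ t =
    o ∘ detach-edge⁻¹ (⟦ s ⟧ ρ) (⟦ t ⟧ ρ) (Safe-⟦⟧ safe s)
  Open-detach {ρ} j safe (nrel _ s t) ≢j o
    rewrite ⟦⟧-detach j ρ s | ⟦⟧-detach j ρ t =
    detach-edge (⟦ s ⟧ ρ) (⟦ t ⟧ ρ) (≢j ∘ cong height) o
  Open-detach {ρ} j safe (TC _ s t) _ (eq , stuck , t≡)
    rewrite ⟦⟧-detach j ρ s | ⟦⟧-detach j ρ t | t≡ =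
    eq , detach-Stuck j (⟦ s ⟧ ρ) stuck , detach-low {j} z≤n
  Open-detach {ρ} j safe (coTC _ s t) _ (eq , below , t≡)
    rewrite ⟦⟧-detach j ρ s | ⟦⟧-detach j ρ t | t≡ =
    eq , detach-Below j (⟦ s ⟧ ρ) below , refl

  -- Stated for all pairs of `coTC` formulas, since the branch is built before any trace on it is
  -- given.
  Rises : Rule TCG → Sequent → Sequent → Valuation → Valuation → Set
  Rises r Γ Δ ρ ρ′ = ∀ {A s t s′ t′} → coTC A s t ∈ Γ → coTC A s′ t′ ∈ Δ →
    (Stay r s t s′ t′ ⊎ Rename r s t s′ t′ → height (⟦ s′ ⟧ ρ′) ≡ height (⟦ s ⟧ ρ)) ×
    (Unfold A r s t s′ t′ → height (⟦ s′ ⟧ ρ′) ≡ suc (height (⟦ s ⟧ ρ)))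

  record Advance (r : Rule TCG) (Δs : List Sequent) (Γ : Sequent) (ρ : Valuation) : Set where
    constructor advance
    field
      {index}     : ℕ
      {premiss}   : Sequent
      is-premiss  : head (drop index Δs) ≡ just premiss
      valuation   : Valuation
      safe        : Safe valuation
      allOpen     : AllOpen valuation premiss
      rises       : Rises r Γ premiss ρ valuation

  coTC-premisses : Formula 2 → Term 0 → Term 0 → ℕ → Sequent → List Sequent
  coTC-premisses A s t c Γ =
    (_⟨_,_⟩ A s t ∷ Γ) ∷ (_⟨_,_⟩ A s (const c) ∷ coTC A (const c) t ∷ Γ) ∷ []

  module _ {ρ} (ρ-safe : Safe ρ) where

    unchanged : ∀ {r Γ Δ} → (∀ {σ} → r ≢ sub σ) → (∀ {A s t c} → r ≢ coTCᵣ A s t c) →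
                Rises r Γ Δ ρ ρ
    unchanged not-sub not-coTC _ _ =
      (λ { (inj₁ (_ , refl , _)) → refl ; (inj₂ (_ , eq , _)) → contradiction eq not-sub }) ,
      (λ { (_ , eq , _) → contradiction eq not-coTC })

    module _ {A s t c} {Γ : Sequent} (fresh : All (Fresh c) (coTC A s t ∷ Γ)) where

      go-left : Edge (⟦ s ⟧ ρ) (⟦ t ⟧ ρ) → AllOpen ρ (coTC A s t ∷ Γ) →
                Advance (coTCᵣ A s t c) (coTC-premisses A s t c Γ) (coTC A s t ∷ Γ) ρ
      go-left edge open! with open! (here refl)
      ... | refl , _ = advance {index = 0} refl ρ ρ-safe (edge ◂ open! ∘ there) λ _ F∈ →
        (λ { (inj₁ (_ , refl , _)) → refl ; (inj₂ (_ , () , _)) }) ,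
        -- No trace unfolds into the left premiss: its `coTC` formulas lie in `Γ`, where the
        -- eigenvariable is fresh.
        (λ { (_ , refl , refl , _) → ⊥-elim (not-fresh F∈) })
        where
        not-fresh : ∀ {u} → ¬ (coTC edge̅ (const c) u ∈ (nrel 0 s t ∷ Γ))
        not-fresh (there F∈) = proj₁ (proj₂ (All.lookup (All.tail fresh) F∈)) refl

      -- The eigenvariable is sent to the next point on the chain of `s`; freshness keeps the side
      -- formulas open. Here `ρ₁` is `ρ` or a detached `ρ`, and `same-height` lets the rise be
      -- measured against `ρ`.
      go-right : ∀ {ρ₁ g n} → Safe ρ₁ → AllOpen ρ₁ (coTC A s t ∷ Γ) →
                 (∀ u → height (⟦ u ⟧ ρ₁) ≡ height (⟦ u ⟧ ρ)) →
                 ⟦ s ⟧ ρ₁ ≡ pt g n → n ≤ L → pt g (suc n) ≢ pt 0 (suc L) →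
                 Advance (coTCᵣ A s t c) (coTC-premisses A s t c Γ) (coTC A s t ∷ Γ) ρ
      go-right {ρ₁} {g} {n} safe₁ open₁ same-height s≡ n≤L new≢ with open₁ (here refl)
      ... | refl , _ , t≡ =
        advance {index = 1} refl ρ₂ (Safe-update c safe₁ new≢)
          (edge ◂ (refl , below , trans (⟦⟧-update t (proj₂ (proj₂ (All.head fresh)))) t≡) ◂ keep)
          λ {_} {u} F∈ _ →
            (λ { (inj₁ (_ , refl , _)) →
                   trans (cong height (⟦⟧-update u (proj₁ (proj₂ (All.lookup fresh F∈))))) (same-height u)
               ; (inj₂ (_ , () , _)) }) ,
            (λ { (_ , refl , refl , _) →
                   trans (cong height new) (cong suc (trans (sym (cong height s≡)) (same-height s))) })
        where
        ρ₂ : Valuation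
        ρ₂ = ρ₁ [ c ↦ pt g (suc n) ]
        new : ρ₂ c ≡ pt g (suc n)
        new = update-≡ ρ₁ c _
        old : ⟦ s ⟧ ρ₂ ≡ pt g n
        old = trans (⟦⟧-update s (proj₁ (proj₂ (All.head fresh)))) s≡
        edge : Edge (⟦ s ⟧ ρ₂) (ρ₂ c)
        edge rewrite old | new = refl , refl
        below : Below (ρ₂ c)
        below rewrite new = s≤s n≤L
        keep : AllOpen ρ₂ Γ
        keep {F} F∈ = Open-update F (All.lookup (All.tail fresh) F∈) (open₁ (there F∈))

    -- By the position of `s`: a detached chain is climbed to its exit at `suc L`, where the left
    -- premiss is taken; chain 0 is climbed to height `L`, where it is detached.
    advance-coTC : ∀ {A s t c Γ j} → All (Fresh c) (coTC A s t ∷ Γ) →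
                   AllOpen ρ (coTC A s t ∷ Γ) → j < L →
                   (∀ {F} → F ∈ coTC A s t ∷ Γ → source ρ F ≢ j) →
                   Advance (coTCᵣ A s t c) (coTC-premisses A s t c Γ) (coTC A s t ∷ Γ) ρ
    advance-coTC {s = s} {t} {j = j} fresh open! j<L missing
      with open! (here refl)
    ... | refl , below , t≡ with ⟦ s ⟧ ρ in s≡
    ... | pt (suc g) n with n ≟ suc L
    ...   | yes n≡ = go-left fresh
              (subst (λ w → Edge w _) (sym s≡) (subst (Edge (pt (suc g) n)) (sym t≡) n≡)) open!
    ...   | no n≢  = go-right fresh ρ-safe open! (λ _ → refl) s≡ (s≤s⁻¹ (≤∧≢⇒< below n≢)) λ ()
    advance-coTC {s = s} {t} {j = j} fresh open! j<L missing
        | refl , below , t≡ | pt zero n with n ≟ L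
    ...   | no n≢ = go-right fresh ρ-safe open! (λ _ → refl) s≡
              (s≤s⁻¹ (≤∧≢⇒< below λ { refl → Safe-⟦⟧ ρ-safe s s≡ })) λ { refl → n≢ refl }
    -- The path to s has grown longer than Γ can remember: cut it at j.
    ...   | yes refl = go-right fresh (λ c eq → <⇒≱ (≤-trans j<L (n≤1+n L)) (detach-low⁻¹ (ρ c) eq))
              (λ {F} F∈ → Open-detach j ρ-safe F (missing F∈) (open! F∈))
              (λ u → trans (cong height (⟦⟧-detach j ρ u)) (height-detach j (⟦ u ⟧ ρ)))
              (trans (⟦⟧-detach j ρ s) (trans (cong (detach j) s≡) (detach-high j<L)))
              ≤-refl λ ()

    -- Logical and equality rules, and `id₁`, have a principal formula that is never open; `id₂`
    -- would need an edge both present and absent. In each remaining rule some premiss can be kept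
    -- open.
    advance! : ∀ {r Δs Γ j} → Infers {TCG} r Δs Γ → AllOpen ρ Γ → j < L →
               (∀ {F} → F ∈ Γ → source ρ F ≢ j) → Advance r Δs Γ ρ
    advance! (id₁ _) open! _ _ = ⊥-elim (open! (here refl))
    advance! (id₂ _) open! _ _ = contradiction (open! (there (here refl))) (open! (here refl))
    advance! (∨₀ _) open! _ _ = ⊥-elim (open! (here refl))
    advance! (∨₁ _) open! _ _ = ⊥-elim (open! (here refl))
    advance! (∧ᵣ _) open! _ _ = ⊥-elim (open! (here refl))
    advance! (∃ᵣ _) open! _ _ = ⊥-elim (open! (here refl))
    advance! (∀ᵣ _ _) open! _ _ = ⊥-elim (open! (here refl))
    advance! (=ᵣ _) open! _ _ = ⊥-elim (open! (here refl))
    advance! (≠₀ _) open! _ _ = ⊥-elim (open! (here refl))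
    advance! (≠₁ _) open! _ _ = ⊥-elim (open! (here refl))
    advance! (wk _ _) open! _ _ =
      advance {index = 0} refl ρ ρ-safe (open! ∘ ∈-++⁺ˡ) (unchanged (λ ()) (λ ()))
    -- The premiss is read under the valuation pulled back along `σ`.
    advance! (sub {σ = σ} _) open! _ _ =
      advance {index = 0} refl (ρ ∘ₛ σ) (λ c → Safe-⟦⟧ ρ-safe (onConst σ c))
        (λ {F} F∈ → Open-subst σ F (open! (∈-map⁺ (substF σ) F∈)))
        λ {_} {_} {_} {s′} _ _ →
          (λ { (inj₁ (not-sub , _)) → ⊥-elim (not-sub tt)
             ; (inj₂ (_ , refl , refl , _)) → cong height (sym (⟦⟧-subst ρ σ s′)) }) ,
          (λ { (_ , () , _) })
    advance! (TC₀ {s = s} {t} _) open! _ _ with open! (here refl)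
    ... | refl , stuck , t≡ =
      advance {index = 0} refl ρ ρ-safe (not-edge ◂ open! ∘ there) (unchanged (λ ()) (λ ()))
      where
      not-edge : ¬ Edge (⟦ t ⟧ ρ) (⟦ s ⟧ ρ)
      not-edge rewrite t≡ with ⟦ s ⟧ ρ
      ... | ∞          = λ ()
      ... | pt (suc _) _ = λ ()
    advance! (TC₁ {s = s} {r} {t} _) open! _ _ with open! (here refl)
    -- Without an edge from `r` to `s` the left premiss is open; with one, `r` is off chain 0 like
    -- `s`, and the right premiss is open.
    ... | refl , stuck , t≡ with edge? (⟦ r ⟧ ρ) (⟦ s ⟧ ρ)
    ...   | no not-edge =
      advance {index = 0} refl ρ ρ-safe (not-edge ◂ open! ∘ there) (unchanged (λ ()) (λ ()))
    ...   | yes edge =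
      advance {index = 1} refl ρ ρ-safe
        ((refl , backwards (⟦ r ⟧ ρ) (⟦ s ⟧ ρ) edge stuck , t≡) ◂ open! ∘ there)
        (unchanged (λ ()) (λ ()))
      where
      backwards : ∀ v w → Edge v w → Stuck w → Stuck v
      backwards (pt (suc _) _) _ _ _ = tt
      backwards (pt zero _) (pt (suc _) _) (() , _) _
    advance! (coTCᵣ _ fresh) open! j<L missing = advance-coTC fresh open! j<L missing

-- A branch without progressing trace in a cut-free cyclic proof.

module CyclicProof (D : Preproof TCG) (vs : List Address)
  (covers : ∀ u → Is-just (label D u) → Any (SameSubtree D u) vs) where

  sequentAt : Address → Sequent
  sequentAt u = maybe′ sequent [] (label D u)

  formulas : Sequent
  formulas = concatMap sequentAt vs

  -- Equal subtrees have equal root sequents as sets, so by regularity the sequents at `vs` contain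
  -- every formula of the proof.
  occurs-in : ∀ {u n F} → label D u ≡ just n → F ∈ sequent n → F ∈ formulas
  occurs-in {u} {n} {F} eq F∈ =
    ∈-concatMap⁺ sequentAt (Any.map transport (covers u (subst Is-just (sym eq) (just tt))))
    where
    transport : ∀ {v} → SameSubtree D u v → F ∈ sequentAt v
    transport {v} ≈ with ≈ []
    ... | p rewrite ++-identityʳ u | ++-identityʳ v | eq with label D v | p
    ... | just _ | just (eqv , _) = Equivalence.to eqv F∈

  -- `avoid` returns some `j` with `j ≤ length formulas`, hence below this `L`.
  open Game (suc (length formulas))

  record State : Set where
    field
      address : Address
      current : Node TCG
      labels  : label D address ≡ just current
      ρ       : Valuation
      safe    : Safe ρ
      allOpen : AllOpen ρ (sequent current)
  open State

  record Successor (x : State) : Set where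
    field
      index   : ℕ
      state   : State
      extends : address state ≡ address x ∷ʳ index
      rises   : Rises (rule (current x)) (sequent (current x)) (sequent (current state))
                  (ρ x) (ρ state)

  next-node : ∀ {x : Maybe Sequent} {y : Maybe (Node TCG)} {Δ} → x ≡ just Δ →
              Pointwise (λ Δ m → Δ ∼[ set ] sequent m) x y →
              ∃[ m ] y ≡ just m × Δ ∼[ set ] sequent m
  next-node refl (just Δ∼) = _ , refl , Δ∼

  -- The cutting height `j` is chosen anew at each step, under the current valuation.
  successor : (x : State) → Successor x
  successor x
    with Δs , Γ , infers , Γ∼ , premisses ← step D (address x) (current x) (labels x)
       | j , j≤ , j∉ ← avoid (map (source (ρ x)) formulas)
    with advance {i} is-premiss ρ′ safe′ open′ rises ←
           advance! (safe x) infers (allOpen x ∘ Equivalence.to Γ∼)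
             (s≤s (subst (j ≤_) (length-map _ formulas) j≤))
             (λ F∈ eq → j∉ (subst (_∈ _) eq
               (∈-map⁺ (source (ρ x)) (occurs-in (labels x) (Equivalence.to Γ∼ F∈)))))
    with m , eq , Δ∼ ← next-node is-premiss (premisses i)
    = record
    { index   = i
    ; state   = record
      { address = address x ∷ʳ i ; current = m
      ; labels = eq ; ρ = ρ′ ; safe = safe′ ; allOpen = open′ ∘ Equivalence.from Δ∼ }
    ; extends = refl
    ; rises   = λ F∈ G∈ → rises (Equivalence.from Γ∼ F∈) (Equivalence.from Δ∼ G∈)
    }

  module _ (initial : State) (at-root : address initial ≡ []) where

    states : ℕ → State
    states zero    = initial
    states (suc i) = Successor.state (successor (states i))

    directions : ℕ → ℕ
    directions i = Successor.index (successor (states i))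

    follows : ∀ i → prefix directions i ≡ address (states i)
    follows zero    = sym at-root
    follows (suc i) =
      trans (cong (_∷ʳ directions i) (follows i)) (sym (Successor.extends (successor (states i))))

    branch : Branch D
    branch = record
      { direction = directions
      ; at        = λ i → current (states i)
      ; on        = λ i → trans (cong (label D) (follows i)) (labels (states i))
      }

    module _ (T : Trace branch) (progressing : Progressing T) where
      open Trace T

      level : ℕ → ℕ
      level i = height (⟦ s i ⟧ (ρ (states i)))

      level-rises : ∀ i → start ≤ i →
        (Stay (rule (current (states i))) (s i) (t i) (s (suc i)) (t (suc i)) ⊎
         Rename (rule (current (states i))) (s i) (t i) (s (suc i)) (t (suc i)) →
         level (suc i) ≡ level i) ×
        (Unfold body (rule (current (states i))) (s i) (t i) (s (suc i)) (t (suc i)) →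
         level (suc i) ≡ suc (level i))
      level-rises i start≤i = Successor.rises (successor (states i))
        (occurs i start≤i) (occurs (suc i) (m≤n⇒m≤1+n start≤i))

      level-step : ∀ i → start ≤ i → level i ≤ level (suc i)
      level-step i start≤i =
        let kept , raised = level-rises i start≤i
            level≡ = ≤-reflexive ∘ sym ∘ kept
            level< = ≤-trans (n≤1+n (level i)) ∘ ≤-reflexive ∘ sym ∘ raised
        in [ level≡ ∘ inj₁ , [ level< , level≡ ∘ inj₂ ]′ ]′ (moves i start≤i)

      level-mono : ∀ {i j} → start ≤ i → i ≤′ j → level i ≤ level j
      level-mono start≤i ≤′-refl       = ≤-refl
      level-mono start≤i (≤′-step i≤j) =
        ≤-trans (level-mono start≤i i≤j) (level-step _ (≤-trans start≤i (≤′⇒≤ i≤j)))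

      -- An unfolding comes after any given step and lifts the level by one; in between the level
      -- never falls.
      climb : ∀ k → ∃[ i ] start ≤ i × k ≤ level i
      climb zero    = start , ≤-refl , z≤n
      climb (suc k) =
        let i , start≤i , k≤ = climb k
            j , i≤j , start≤j , unfold = progressing i
        in suc j , m≤n⇒m≤1+n start≤j ,
           ≤-trans (s≤s (≤-trans k≤ (level-mono start≤i (≤⇒≤′ i≤j))))
                   (≤-reflexive (sym (proj₂ (level-rises j start≤j) unfold)))

      absurd : ⊥
      absurd =
        -- This is `suc (suc L)`, one more than the bound `Below` puts on open left ends.
        let i , start≤i , high = climb (suc (suc (suc (length formulas))))
            _ , below , _ = allOpen (states i) (occurs i start≤i)
        in 1+n≰n (≤-trans high (Below-height _ below))

no-cyclic-proof : ¬ HasCyclicProof TCG converse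
no-cyclic-proof (D , (n , at-root , proves) , isProof , vs , covers) =
  isProof (branch initial refl) λ (T , progressing) → absurd initial refl T progressing
  where
  open CyclicProof D vs covers
  initial : State
  initial = record
    { address = [] ; current = n ; labels = at-root
    ; ρ = ρ₀ ; safe = safe₀ ; allOpen = λ F∈ → open₀ (Equivalence.to proves F∈)
    }
    where
    open Game (suc (length formulas))
    ρ₀ : Valuation
    -- The constant `c` starts the path; all others, `d` included, denote the target.
    ρ₀ zero    = pt 0 0
    ρ₀ (suc _) = ∞
    safe₀ : Safe ρ₀
    safe₀ zero    ()
    safe₀ (suc _) ()
    open₀ : AllOpen ρ₀ converse
    open₀ (here refl)         = refl , z≤n , refl
    open₀ (there (here refl)) = refl , tt , refl

corollary3p12 : ∃[ Γ ] (HasCyclicProof TCG+cut Γ × ¬ HasCyclicProof TCG Γ)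
corollary3p12 = converse , cyclic-proof , no-cyclic-proof
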